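{- For each $n\in\mathbb{N}$, let $C_n$ be the number of weak-Schreier subsets of $\{1,2,\ldots,n\}$ (including the empty set), and let $E_n$ be the number of Zeckendorf subsets of $\{1,2,\ldots,n\}$ (including the empty set). Then $C_n=E_n$ for each $n\in\mathbb{N}$.
   Context: $\mathbb{N}=\{1,2,3,\ldots\}$. A nonempty finite set $S\subseteq\mathbb{N}$ is weak-Schreier if $\min S\ge |S|$; the empty set is counted as weak-Schreier. A finite set of natural numbers is Zeckendorf if it does not contain two consecutive natural numbers. -}

module Defs where

open import Data.Fin using (Fin; toℕ)
open import Data.Fin.Properties using (any?)
open import Data.Fin.Subset using (Subset; inside; outside; _∈_; Empty; Lift; ∣_∣)
open import Data.Fin.Subset.Properties using (_∈?_; nonempty?; Lift?)
open import Data.List using (List; []; _∷_; _++_; map; filter; length)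
open import Data.Nat using (ℕ; zero; suc; _≤_; _≥_; _≤?_; _≥?_; _≟_)
open import Data.Product using (_×_; ∃)
open import Data.Sum using (_⊎_)
open import Data.Vec as Vec using ()
open import Relation.Binary.PropositionalEquality using (_≡_)
open import Relation.Nullary using (¬_)
open import Relation.Nullary.Decidable using (_×-dec_; _⊎-dec_; ¬?)
open import Relation.Unary using (Decidable)

private
  variable
    n : ℕ

-- A 'Subset n' stands for a subset of {1, …, n}: since 'Fin n' counts from
-- zero, its element i represents the natural number 1 + i.
value : Fin n → ℕ
value i = suc (toℕ i)

IsMin : Subset n → Fin n → Set
IsMin p i = i ∈ p × Lift (λ j → value i ≤ value j) p

WeakSchreier : Subset n → Set
WeakSchreier p = Empty p ⊎ ∃ λ i → IsMin p i × value i ≥ ∣ p ∣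

Zeckendorf : Subset n → Set
Zeckendorf p = ¬ (∃ λ i → ∃ λ j → i ∈ p × j ∈ p × value j ≡ suc (value i))

weakSchreier? : Decidable (WeakSchreier {n})
weakSchreier? p =
  ¬? (nonempty? p) ⊎-dec
  any? λ i → ((i ∈? p) ×-dec Lift? (λ j → value i ≤? value j) p)
             ×-dec (value i ≥? ∣ p ∣)

zeckendorf? : Decidable (Zeckendorf {n})
zeckendorf? p =
  ¬? (any? λ i → any? λ j →
    (i ∈? p) ×-dec (j ∈? p) ×-dec (value j ≟ suc (value i)))

-- Every subset occurs exactly once.
subsets : (n : ℕ) → List (Subset n)
subsets zero    = Vec.[] ∷ []
subsets (suc n) = map (outside Vec.∷_) (subsets n) ++ map (inside Vec.∷_) (subsets n)

C : ℕ → ℕ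
C n = length (filter weakSchreier? (subsets n))

E : ℕ → ℕ
E n = length (filter zeckendorf? (subsets n))

{-# OPTIONS --safe #-}
-- Requiring |p| ≤ i + k for every i ∈ p, where k records a shift, makes the
-- weak-Schreier condition stable under deleting the point 1.  Removing the
-- largest element of a set while lowering k by one suggests the Pascal-type rule
-- w(n+1, k+1) = w(n, k+1) + w(n, k) for the number w(n, k) of such sets.  Splitting on
-- whether 1 belongs to the set proves this rule by induction on n, and yields
-- w(n+2, 0) = w(n+1, 0) + w(n, 0), the Fibonacci recurrence that also counts
-- Zeckendorf sets.
module Submission where

open import Defs
open import Algebra.Properties.CommutativeSemigroup using (interchange; xy∙z≈xz∙y)
open import Data.Bool using (true; false)
open import Data.Empty using (⊥-elim)
open import Data.Fin using (zero; suc)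
open import Data.Fin.Subset using (Subset; inside; outside; Empty; Lift; ∣_∣)
open import Data.Fin.Subset.Properties using (Lift?)
open import Data.List using (List; []; _∷_; _++_; filter; length; map)
open import Data.List.Properties using (filter-++; filter-≐; filter-none; length-++)
open import Data.List.Relation.Unary.All using (universal)
open import Data.Nat using (ℕ; zero; suc; _+_; _≤_; _≤?_; z≤n; s≤s; s≤s⁻¹; NonZero)
open import Data.Nat.Properties using (+-commutativeSemigroup; +-identityʳ; +-suc; m≤n+m; suc-injective; ≤-reflexive; ≤-trans)
open import Data.Product using (∃; _,_; proj₁)
open import Data.Sum using (_⊎_; inj₁; inj₂)
open import Data.Vec using ([]; _∷_; here; there)
open import Function using (_∘_)
open import Level using (0ℓ)
open import Relation.Binary.PropositionalEquality using (_≡_; refl; sym; trans; cong; cong₂; module ≡-Reasoning)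
open import Relation.Nullary using (¬_; does)
open import Relation.Unary using (Pred; Decidable; _≐_)

open ≡-Reasoning

private
  variable
    n : ℕ

count : ∀ n {P : Pred (Subset n) 0ℓ} → Decidable P → ℕ
count n P? = length (filter P? (subsets n))

count-≐ : ∀ n {P Q : Pred (Subset n) 0ℓ} (P? : Decidable P) (Q? : Decidable Q) →
          P ≐ Q → count n P? ≡ count n Q?
count-≐ n P? Q? P≐Q = cong length (filter-≐ P? Q? P≐Q (subsets n))

count-none : ∀ n {P : Pred (Subset n) 0ℓ} (P? : Decidable P) →
             (∀ p → ¬ P p) → count n P? ≡ 0
count-none n P? ¬P = cong length (filter-none P? (universal ¬P (subsets n)))

length-filter-map : {A B : Set} {P : Pred B 0ℓ} (P? : Decidable P) (f : A → B) (xs : List A) →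
                    length (filter P? (map f xs)) ≡ length (filter (P? ∘ f) xs)
length-filter-map P? f []       = refl
length-filter-map P? f (x ∷ xs) with does (P? (f x))
... | true  = cong suc (length-filter-map P? f xs)
... | false = length-filter-map P? f xs

count-∷ : ∀ n {P : Pred (Subset (suc n)) 0ℓ} (P? : Decidable P) →
          count (suc n) P? ≡ count n (P? ∘ (outside ∷_)) + count n (P? ∘ (inside ∷_))
count-∷ n P? = begin
  length (filter P? (out ++ ins))
    ≡⟨ cong length (filter-++ P? out ins) ⟩
  length (filter P? out ++ filter P? ins)
    ≡⟨ length-++ (filter P? out) ⟩
  length (filter P? out) + length (filter P? ins)
    ≡⟨ cong₂ _+_ (length-filter-map P? _ (subsets n)) (length-filter-map P? _ (subsets n)) ⟩
  count n (P? ∘ (outside ∷_)) + count n (P? ∘ (inside ∷_)) ∎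
  where
  out = map (outside ∷_) (subsets n)
  ins = map (inside ∷_) (subsets n)

-- This is what the shifted condition below leaves for the other points once 1 is in the set. The
-- counts `smalls n k` are partial sums of the binomial coefficients of row `n`, whence their Pascal
-- rule.
Small : ℕ → Subset n → Set
Small k p = ∣ p ∣ ≤ k

small? : ∀ k → Decidable (Small {n} k)
small? k p = ∣ p ∣ ≤? k

smalls : ℕ → ℕ → ℕ
smalls n k = count n (small? {n} k)

smalls-zero : ∀ n → smalls n 0 ≡ 1
smalls-zero zero    = refl
smalls-zero (suc n) = begin
  smalls (suc n) 0
    ≡⟨ count-∷ n (small? 0) ⟩
  smalls n 0 + count n (small? 0 ∘ (inside ∷_))
    ≡⟨ cong₂ _+_ (smalls-zero n) (count-none n (small? 0 ∘ (inside ∷_)) (λ _ ())) ⟩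
  1 ∎

count-small-inside : ∀ n k → count n (small? {suc n} (suc k) ∘ (inside ∷_)) ≡ smalls n k
count-small-inside n k = count-≐ n _ (small? k) ((λ { (s≤s h) → h }) , s≤s)

smalls-suc : ∀ n k → smalls (suc n) (suc k) ≡ smalls n (suc k) + smalls n k
smalls-suc n k =
  trans (count-∷ n (small? (suc k))) (cong (smalls n (suc k) +_) (count-small-inside n k))

-- Bounding at every element instead of at the minimum avoids choosing a minimum and covers the
-- empty set vacuously.
ShiftedSchreier : ℕ → Subset n → Set
ShiftedSchreier k p = Lift (λ i → ∣ p ∣ ≤ value i + k) p

shiftedSchreier? : ∀ k → Decidable (ShiftedSchreier {n} k)
shiftedSchreier? k p = Lift? (λ i → ∣ p ∣ ≤? value i + k) p

shifteds : ℕ → ℕ → ℕ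
shifteds n k = count n (shiftedSchreier? {n} k)

-- Dropping the absent point 1 renumbers every element down by one; the shift goes up by one to
-- compensate.
shifted-outside : ∀ k → (ShiftedSchreier k ∘ (outside ∷_)) ≐ ShiftedSchreier {n} (suc k)
shifted-outside k =
    (λ h {i} i∈p → ≤-trans (h (there i∈p)) (≤-reflexive (sym (+-suc (value i) k))))
  , (λ { h {suc i} (there i∈p) → ≤-trans (h i∈p) (≤-reflexive (+-suc (value i) k)) })

-- The element 1 is the minimum, so its bound `1 + k` is the tightest and implies all others; 1
-- itself accounts for one unit of the size.
shifted-inside : ∀ k → (ShiftedSchreier k ∘ (inside ∷_)) ≐ Small {n} k
shifted-inside k =
    (λ h → s≤s⁻¹ (h here))
  , (λ { h {zero} _ → s≤s h ; h {suc i} _ → s≤s (≤-trans h (m≤n+m k (value i))) })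

shifteds-∷ : ∀ n k → shifteds (suc n) k ≡ shifteds n (suc k) + smalls n k
shifteds-∷ n k = trans (count-∷ n (shiftedSchreier? k))
  (cong₂ _+_ (count-≐ n _ (shiftedSchreier? (suc k)) (shifted-outside k))
             (count-≐ n _ (small? k) (shifted-inside k)))

-- The induction is on `n` for all `k` at once, since unfolding raises the shift. Both summands of
-- `shifteds-∷` obey the same Pascal rule, so regrouping their four terms gives the rule for the
-- sum.
shifteds-pascal : ∀ n k → shifteds (suc n) (suc k) ≡ shifteds n (suc k) + shifteds n k
-- Over the empty ground set all four counts compute to 1.
shifteds-pascal zero    k = shifteds-∷ 0 (suc k)
shifteds-pascal (suc n) k = begin
  shifteds (2 + n) (1 + k)
    ≡⟨ shifteds-∷ (suc n) (suc k) ⟩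
  shifteds (1 + n) (2 + k) + smalls (1 + n) (1 + k)
    ≡⟨ cong₂ _+_ (shifteds-pascal n (suc k)) (smalls-suc n k) ⟩
  (shifteds n (2 + k) + shifteds n (1 + k)) + (smalls n (1 + k) + smalls n k)
    ≡⟨ interchange +-commutativeSemigroup (shifteds n (2 + k)) (shifteds n (1 + k)) (smalls n (1 + k)) (smalls n k) ⟩
  (shifteds n (2 + k) + smalls n (1 + k)) + (shifteds n (1 + k) + smalls n k)
    ≡⟨ cong₂ _+_ (shifteds-∷ n (suc k)) (shifteds-∷ n k) ⟨
  shifteds (1 + n) (1 + k) + shifteds (1 + n) k ∎

shifteds-zero-fib : ∀ n → shifteds (2 + n) 0 ≡ shifteds (1 + n) 0 + shifteds n 0
shifteds-zero-fib n = begin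
  shifteds (2 + n) 0
    ≡⟨ shifteds-∷ (suc n) 0 ⟩
  shifteds (1 + n) 1 + smalls (1 + n) 0
    -- Only the empty set has size at most 0, whatever the ground set. Hence `smalls (1 + n) 0` may
    -- become `smalls n 0`, the term needed to fold `shifteds (1 + n) 0` back up.
    ≡⟨ cong₂ _+_ (shifteds-pascal n 0) (trans (smalls-zero (suc n)) (sym (smalls-zero n))) ⟩
  (shifteds n 1 + shifteds n 0) + smalls n 0
    ≡⟨ xy∙z≈xz∙y +-commutativeSemigroup (shifteds n 1) (shifteds n 0) (smalls n 0) ⟩
  (shifteds n 1 + smalls n 0) + shifteds n 0
    ≡⟨ cong (_+ shifteds n 0) (shifteds-∷ n 0) ⟨
  shifteds (1 + n) 0 + shifteds n 0 ∎

empty⊎min : (p : Subset n) → Empty p ⊎ ∃ (IsMin p)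
empty⊎min []           = inj₁ λ ()
empty⊎min (inside ∷ p) = inj₂ (zero , here , λ _ → s≤s z≤n)
empty⊎min (outside ∷ p) with empty⊎min p
... | inj₁ ∅         = inj₁ λ { (suc i , there i∈p) → ∅ (i , i∈p) }
... | inj₂ (i , i∈p , min) = inj₂ (suc i , there i∈p , λ { (there j∈p) → s≤s (min j∈p) })

-- The bound at the minimum passes to all larger elements; conversely, a nonempty set has a minimum
-- at which to read it off.
weakSchreier≐shifted : WeakSchreier {n} ≐ ShiftedSchreier 0
weakSchreier≐shifted {n} = to , from
  where
  to : ∀ {p : Subset n} → WeakSchreier p → ShiftedSchreier 0 p
  to (inj₁ ∅) i∈p = ⊥-elim (∅ (_ , i∈p))
  to (inj₂ (i , (_ , min) , h)) {j} j∈p =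
    ≤-trans h (≤-trans (min j∈p) (≤-reflexive (sym (+-identityʳ (value j)))))

  from : ∀ {p : Subset n} → ShiftedSchreier 0 p → WeakSchreier p
  from {p} h with empty⊎min p
  ... | inj₁ ∅ = inj₁ ∅
  ... | inj₂ (i , isMin) =
    inj₂ (i , isMin , ≤-trans (h (proj₁ isMin)) (≤-reflexive (+-identityʳ (value i))))

C≡shifteds : ∀ n → C n ≡ shifteds n 0
C≡shifteds n = count-≐ n weakSchreier? (shiftedSchreier? 0) weakSchreier≐shifted

C-fib : ∀ n → C (2 + n) ≡ C (1 + n) + C n
C-fib n = begin
  C (2 + n)                         ≡⟨ C≡shifteds (2 + n) ⟩
  shifteds (2 + n) 0                ≡⟨ shifteds-zero-fib n ⟩
  shifteds (1 + n) 0 + shifteds n 0 ≡⟨ cong₂ _+_ (C≡shifteds (1 + n)) (C≡shifteds n) ⟨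
  C (1 + n) + C n                   ∎

zeckendorf-outside : (Zeckendorf ∘ (outside ∷_)) ≐ Zeckendorf {n}
zeckendorf-outside =
    (λ { z (i , j , i∈p , j∈p , e) → z (suc i , suc j , there i∈p , there j∈p , cong suc e) })
  , (λ { z (suc i , suc j , there i∈p , there j∈p , e) → z (i , j , i∈p , j∈p , suc-injective e) })

-- With 2 absent, 1 has no neighbour in the set, so any consecutive pair lies among the points from
-- 3 on.
zeckendorf-inside-outside : (Zeckendorf ∘ (λ p → inside ∷ outside ∷ p)) ≐ Zeckendorf {n}
zeckendorf-inside-outside =
    (λ { z (i , j , i∈p , j∈p , e) →
         z (suc (suc i) , suc (suc j) , there (there i∈p) , there (there j∈p) , cong (2 +_) e) })
  , (λ { z (zero , zero , _ , _ , ())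
       ; z (zero , suc zero , _ , there () , _)
       ; z (zero , suc (suc j) , _ , _ , ())
       ; z (suc i , zero , _ , _ , ())
       ; z (suc zero , suc _ , there () , _ , _)
       ; z (suc (suc i) , suc zero , _ , there () , _)
       ; z (suc (suc i) , suc (suc j) , there (there i∈p) , there (there j∈p) , e) →
           z (i , j , i∈p , j∈p , suc-injective (suc-injective e)) })

¬zeckendorf-inside-inside : ∀ (p : Subset n) → ¬ Zeckendorf (inside ∷ inside ∷ p)
¬zeckendorf-inside-inside p z = z (zero , suc zero , here , there here , refl)

-- The sets without 1 give the first term. Those with 1 must omit 2, and are then free on the last
-- `n` points.
E-fib : ∀ n → E (2 + n) ≡ E (1 + n) + E n
E-fib n = begin
  E (2 + n)
    ≡⟨ count-∷ (1 + n) zeckendorf? ⟩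
  count (1 + n) (zeckendorf? ∘ (outside ∷_)) + count (1 + n) (zeckendorf? ∘ (inside ∷_))
    ≡⟨ cong₂ _+_ (count-≐ (1 + n) _ zeckendorf? zeckendorf-outside) (count-∷ n (zeckendorf? ∘ (inside ∷_))) ⟩
  E (1 + n) + (count n (zeckendorf? ∘ (λ p → inside ∷ outside ∷ p)) +
               count n (zeckendorf? ∘ (λ p → inside ∷ inside ∷ p)))
    ≡⟨ cong (E (1 + n) +_) (cong₂ _+_
         (count-≐ n _ zeckendorf? zeckendorf-inside-outside)
         (count-none n _ ¬zeckendorf-inside-inside)) ⟩
  E (1 + n) + (E n + 0)
    ≡⟨ cong (E (1 + n) +_) (+-identityʳ (E n)) ⟩
  E (1 + n) + E n ∎

C≡E : ∀ n → C n ≡ E n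
-- The two initial values, 1 and 2 on both sides, are found by evaluating the filters.
C≡E 0             = refl
C≡E 1             = refl
C≡E (suc (suc n)) = begin
  C (2 + n)       ≡⟨ C-fib n ⟩
  C (1 + n) + C n ≡⟨ cong₂ _+_ (C≡E (suc n)) (C≡E n) ⟩
  E (1 + n) + E n ≡⟨ E-fib n ⟨
  E (2 + n)       ∎

theorem3 : (n : ℕ) → .{{_ : NonZero n}} → C n ≡ E n
theorem3 n = C≡E n
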